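{- For every finite Coxeter system $(W,S)$, the $W$-permutahedron is in-your-face. That is, for any two vertices $v,v'$ of the $W$-permutahedron, every geodesic from $v$ to $v'$ in its $1$-skeleton stays in the minimal face of the $W$-permutahedron containing both $v$ and $v'$.
   Context: Polytopes and geodesics. Let $P$ be a finite convex polytope. For vertices $v,v'$ write $v\to v'$ if they are adjacent in the $1$-skeleton of $P$ or $v=v'$. A path from $v$ to $v'$ is a sequence $v=v_1\to v_2\to\cdots\to v_k=v'$; a geodesic from $v$ to $v'$ is a path of minimal length. $P$ is called in-your-face if for all vertices $v,v'$, any geodesic from $v$ to $v'$ stays in (i.e. all its vertices lie in) the minimal face containing both $v$ and $v'$. The $W$-permutahedron. Let $(W,S)$ be a finite Coxeter system acting on Euclidean space by its reflection representation. The $W$-permutahedron $\mathsf{Perm}(W)$ is the convex hull of the $W$-orbit of a generic point (a point on no reflecting hyperplane). Its vertices are in bijection with the elements $w\in W$. Its faces correspond to the cosets $wW_J$ for $w\in W$ and $J\subseteq S$, where $W_J$ is the standard parabolic subgroup generated by $J$; the vertices of the face $wW_J$ are the elements of that coset. In particular the edges join $w$ and $ws$ for $w\in W$, $s\in S$, and the facets are the cosets $wW_{\langle s\rangle}$, where $W_{\langle s\rangle}=W_{S\setminus\{s\}}$. -}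

module Defs where

open import Level using (Level; _⊔_; 0ℓ) renaming (suc to lsuc)
open import Algebra.Bundles using (Group)
open import Algebra.Morphism.Structures using (module GroupMorphisms)
open import Data.Fin.Base using (Fin)
open import Data.Fin.Subset using (Subset) renaming (_∈_ to _∈ˢ_)
open import Data.Nat.Base using (ℕ; zero; suc; _≤_)
open import Data.Product.Base using (Σ-syntax; ∃-syntax; _×_; _,_)
open import Data.Sum.Base using (_⊎_)
open import Function.Bundles using (Inverse; _⇔_)
open import Relation.Binary.Bundles using (Setoid)
open import Relation.Binary.PropositionalEquality as ≡ using (_≡_; _≢_)
open import Relation.Nullary.Negation using (¬_)
open import Relation.Unary using (Pred)

------------------------------------------------------------------------
-- Group presentations

infixl 7 _·_
infix  8 _⁻
infixr 9 _^_

data Term (X : Set) : Set where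
  gen  : X → Term X
  one  : Term X
  _·_  : Term X → Term X → Term X
  _⁻   : Term X → Term X

_^_ : {X : Set} → Term X → ℕ → Term X
t ^ zero  = one
t ^ suc k = t · t ^ k

infix 4 _⊢_≈_

-- The least group congruence on terms that kills every relator r i.
data _⊢_≈_ {X I : Set} (r : I → Term X) : Term X → Term X → Set where
  ≈-refl    : ∀ {t} → r ⊢ t ≈ t
  ≈-sym     : ∀ {t u} → r ⊢ t ≈ u → r ⊢ u ≈ t
  ≈-trans   : ∀ {t u v} → r ⊢ t ≈ u → r ⊢ u ≈ v → r ⊢ t ≈ v
  ·-cong    : ∀ {t t′ u u′} → r ⊢ t ≈ t′ → r ⊢ u ≈ u′ → r ⊢ t · u ≈ t′ · u′
  ⁻-cong    : ∀ {t t′} → r ⊢ t ≈ t′ → r ⊢ t ⁻ ≈ t′ ⁻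
  ·-assoc   : ∀ t u v → r ⊢ (t · u) · v ≈ t · (u · v)
  ·-oneˡ    : ∀ t → r ⊢ one · t ≈ t
  ·-oneʳ    : ∀ t → r ⊢ t · one ≈ t
  ·-⁻ˡ      : ∀ t → r ⊢ t ⁻ · t ≈ one
  ·-⁻ʳ      : ∀ t → r ⊢ t · t ⁻ ≈ one
  relator   : ∀ i → r ⊢ r i ≈ one

Presented : {X I : Set} → (I → Term X) → Group 0ℓ 0ℓ
Presented {X} r = record
  { Carrier = Term X
  ; _≈_     = r ⊢_≈_
  ; _∙_     = _·_
  ; ε       = one
  ; _⁻¹     = _⁻
  ; isGroup = record
    { isMonoid = record
      { isSemigroup = record
        { isMagma = record
          { isEquivalence = record { refl = ≈-refl ; sym = ≈-sym ; trans = ≈-trans }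
          ; ∙-cong        = ·-cong
          }
        ; assoc = ·-assoc
        }
      ; identity = ·-oneˡ , ·-oneʳ
      }
    ; inverse = ·-⁻ˡ , ·-⁻ʳ
    ; ⁻¹-cong = ⁻-cong
    }
  }

module _ {c ℓ} (G : Group c ℓ) where
  private module G = Group G

  eval : {X : Set} → (X → G.Carrier) → Term X → G.Carrier
  eval f (gen x) = f x
  eval f one     = G.ε
  eval f (t · u) = eval f t G.∙ eval f u
  eval f (t ⁻)   = eval f t G.⁻¹

  -- The subgroup generated by a subset A.
  data Generated {p} (A : Pred G.Carrier p) : Pred G.Carrier (c ⊔ ℓ ⊔ p) where
    member : ∀ {x} → A x → Generated A x
    unit   : Generated A G.ε
    mul    : ∀ {x y} → Generated A x → Generated A y → Generated A (x G.∙ y)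
    inv    : ∀ {x} → Generated A x → Generated A (x G.⁻¹)
    resp   : ∀ {x y} → x G.≈ y → Generated A x → Generated A y

------------------------------------------------------------------------
-- Coxeter systems

-- The entry m i j = 0 encodes m(i,j) = ∞: the relator (sᵢsⱼ)⁰ is trivial.
record CoxeterMatrix (n : ℕ) : Set where
  field
    m        : Fin n → Fin n → ℕ
    m-sym    : ∀ i j → m i j ≡ m j i
    diagonal : ∀ i → m i i ≡ 1
    off-diag : ∀ i j → i ≢ j → m i j ≢ 1

  coxeterRelator : Fin n × Fin n → Term (Fin n)
  coxeterRelator (i , j) = (gen i · gen j) ^ m i j

-- S is the family s, whose injectivity is a consequence of the presentation.
record CoxeterSystem c ℓ : Set (lsuc (c ⊔ ℓ)) where
  field
    W      : Group c ℓ
    rank   : ℕ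
    matrix : CoxeterMatrix rank
    s      : Fin rank → Group.Carrier W

  open CoxeterMatrix matrix public

  field
    presentation : GroupMorphisms.IsGroupIsomorphism
                     (Group.rawGroup (Presented coxeterRelator))
                     (Group.rawGroup W)
                     (eval W s)

  open Group W public

  -- The standard parabolic subgroup W_J.
  Parabolic : Subset rank → Pred Carrier (c ⊔ ℓ)
  Parabolic J = Generated W (λ x → ∃[ i ] (i ∈ˢ J × x ≈ s i))

  -- x ∈Coset (w , J) says that x lies in w W_J.
  _∈Coset_ : Carrier → Carrier × Subset rank → Set (c ⊔ ℓ)
  x ∈Coset (w , J) = ∃[ y ] (Parabolic J y × x ≈ w ∙ y)

FiniteSetoid : ∀ {c ℓ} → Setoid c ℓ → Set (c ⊔ ℓ)
FiniteSetoid A = ∃[ N ] Inverse A (≡.setoid (Fin N))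

Finite : ∀ {c ℓ} → CoxeterSystem c ℓ → Set (c ⊔ ℓ)
Finite C = FiniteSetoid (CoxeterSystem.setoid C)

------------------------------------------------------------------------
-- Polytopes, seen through their vertices and (nonempty) faces

record FaceStructure c ℓ f e : Set (lsuc (c ⊔ ℓ ⊔ f ⊔ e)) where
  field
    vertices : Setoid c ℓ
    Face     : Set f

  open Setoid vertices public renaming (Carrier to Vertex)

  field
    _∈_      : Vertex → Face → Set e
    ∈-resp-≈ : ∀ {u v F} → u ≈ v → u ∈ F → v ∈ F

  -- The edges of a polytope are its faces with exactly two vertices.
  Adjacent : Vertex → Vertex → Set (c ⊔ ℓ ⊔ f ⊔ e)
  Adjacent v v′ = ¬ v ≈ v′ × Σ[ F ∈ Face ] (∀ u → u ∈ F ⇔ (u ≈ v ⊎ u ≈ v′))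

  _⟶_ : Vertex → Vertex → Set (c ⊔ ℓ ⊔ f ⊔ e)
  v ⟶ v′ = Adjacent v v′ ⊎ v ≈ v′

  -- A sequence v = v₁ ⟶ ⋯ ⟶ vₖ = v′ with k ≥ 1.
  infixr 5 _∷_
  data Path (v v′ : Vertex) : Set (c ⊔ ℓ ⊔ f ⊔ e) where
    [_] : v ≈ v′ → Path v v′
    _∷_ : ∀ {u} → v ⟶ u → Path u v′ → Path v v′

  -- The number of steps, k - 1.
  length : ∀ {v v′} → Path v v′ → ℕ
  length [ _ ]   = zero
  length (_ ∷ p) = suc (length p)

  IsGeodesic : ∀ {v v′} → Path v v′ → Set (c ⊔ ℓ ⊔ f ⊔ e)
  IsGeodesic {v} {v′} p = ∀ (q : Path v v′) → length p ≤ length q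

  StaysIn : Face → ∀ {v v′} → Path v v′ → Set e
  StaysIn F {v} [ _ ]   = v ∈ F
  StaysIn F {v} (_ ∷ p) = v ∈ F × StaysIn F p

  IsMinimalFace : Vertex → Vertex → Face → Set (c ⊔ f ⊔ e)
  IsMinimalFace v v′ F =
    v ∈ F × v′ ∈ F × (∀ G → v ∈ G → v′ ∈ G → ∀ u → u ∈ F → u ∈ G)

  -- The minimal face, which determines its vertex set uniquely, is asserted
  -- to exist so that the condition cannot hold vacuously.
  InYourFace : Set (c ⊔ ℓ ⊔ f ⊔ e)
  InYourFace = ∀ v v′ →
    Σ[ F ∈ Face ] (IsMinimalFace v v′ F ×
                   (∀ (p : Path v v′) → IsGeodesic p → StaysIn F p))

-- The W-permutahedron: a vertex of the convex hull of a generic orbit is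
-- identified with an element of W, and a face with a coset w W_J, given by a
-- pair (w , J).  Different pairs may describe the same face.
Perm : ∀ {c ℓ} → CoxeterSystem c ℓ → FaceStructure c ℓ c (c ⊔ ℓ)
Perm C = record
  { vertices = setoid
  ; Face     = Carrier × Subset rank
  ; _∈_      = _∈Coset_
  ; ∈-resp-≈ = λ { u≈v (y , y∈ , u≈) → y , y∈ , trans (sym u≈v) u≈ }
  }
  where open CoxeterSystem C

{-# OPTIONS --safe #-}
-- For x ∈ W and y ∈ W let N x y be the parity of the number of times that y
-- occurs among the reflections s₁⋯sₖ₋₁ sₖ sₖ₋₁⋯s₁ of a word s₁⋯sₙ for x.  This
-- satisfies the cocycle rule N (x z) y = N x y + N z (x⁻¹ y x) and is trivial on
-- the relators, so it does not depend on the word.  If x ∈ W_K, then N x y = 1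
-- forces y ∈ W_K; and N x s = 1 for a letter s allows one to delete a letter from
-- any word for x and obtain a word for s x.  Now let s be the first letter of a
-- shortest word for x = s z ∈ W_K.  Then N z s = 0, so N x s = 1 and s ∈ W_K, and
-- the remaining letters follow by induction.  Hence all letters of a shortest word
-- for v⁻¹ v′ lie in every W_K containing v⁻¹ v′.
module Submission where

open import Defs

open import Algebra.Bundles using (Group)
open import Algebra.Morphism.Structures using (module GroupMorphisms)
import Algebra.Properties.Group as GroupProperties
open import Data.Bool.Base using (Bool; true; false; _xor_)
open import Data.Bool.Properties using (xor-assoc; xor-same; xor-identityʳ)
open import Data.Empty using (⊥-elim)
open import Data.Fin.Base using (Fin)
import Data.Fin.Properties as Fin
open import Data.Fin.Subset using (Subset; ⊥; ⁅_⁆; _∪_) renaming (_∈_ to _∈ˢ_)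
open import Data.Fin.Subset.Properties
  using (∉⊥; nonempty?; x∈⁅x⁆; x∈⁅y⁆⇒x≡y; p⊆p∪q; q⊆p∪q; x∈p∪q⁻)
open import Data.List.Base using (List; []; _∷_; _++_; length; reverse)
open import Data.List.Properties using (unfold-reverse)
open import Data.List.Relation.Unary.All using (All; []; _∷_)
open import Data.Nat.Base using (ℕ; zero; suc; _≤_; z≤n; s≤s; _+_; _*_)
import Data.Nat.Properties as ℕ
open import Data.Product.Base using (Σ-syntax; ∃-syntax; _×_; _,_; proj₁; proj₂)
open import Data.Sum.Base using (_⊎_; inj₁; inj₂; [_,_]′)
open import Function.Base using (_∘_)
open import Function.Bundles using (Equivalence; mk⇔)
open import Function.Properties.Inverse using (Inverse⇒Injection)
open import Relation.Binary.Definitions using (Decidable)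
open import Relation.Binary.PropositionalEquality as ≡ using (_≡_; module ≡-Reasoning)
import Relation.Binary.Reasoning.Setoid as SetoidReasoning
open import Relation.Nullary using (¬_; yes; no; does)
open import Relation.Nullary.Decidable using (does-⇔; dec-true; via-injection)
open import Relation.Unary using (Pred; _⊆_)

-- Conjugation in a group, with identities for involutions.

module Conjugation {c ℓ} (G : Group c ℓ) where
  open Group G
  open GroupProperties G
  open SetoidReasoning setoid

  conj : Carrier → Carrier → Carrier
  conj g x = g ∙ x ∙ g ⁻¹

  conj-cong : ∀ {g h x y} → g ≈ h → x ≈ y → conj g x ≈ conj h y
  conj-cong g≈h x≈y = ∙-cong (∙-cong g≈h x≈y) (⁻¹-cong g≈h)

  conj-congʳ : ∀ g {x y} → x ≈ y → conj g x ≈ conj g y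
  conj-congʳ g = conj-cong refl

  conj-ε : ∀ x → conj ε x ≈ x
  conj-ε x = begin
    ε ∙ x ∙ ε ⁻¹  ≈⟨ ∙-cong (identityˡ x) ε⁻¹≈ε ⟩
    x ∙ ε         ≈⟨ identityʳ x ⟩
    x             ∎

  conj-∙ : ∀ g h x → conj (g ∙ h) x ≈ conj g (conj h x)
  conj-∙ g h x = begin
    g ∙ h ∙ x ∙ (g ∙ h) ⁻¹       ≈⟨ ∙-cong (assoc g h x) (⁻¹-anti-homo-∙ g h) ⟩
    g ∙ (h ∙ x) ∙ (h ⁻¹ ∙ g ⁻¹)  ≈⟨ assoc _ _ _ ⟨
    g ∙ (h ∙ x) ∙ h ⁻¹ ∙ g ⁻¹    ≈⟨ ∙-congʳ (assoc _ _ _) ⟩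
    g ∙ (h ∙ x ∙ h ⁻¹) ∙ g ⁻¹    ∎

  conj-inverse : ∀ {g h} x → g ∙ h ≈ ε → conj g (conj h x) ≈ x
  conj-inverse {g} {h} x gh≈ε = begin
    conj g (conj h x)  ≈⟨ conj-∙ g h x ⟨
    conj (g ∙ h) x     ≈⟨ conj-cong gh≈ε refl ⟩
    conj ε x           ≈⟨ conj-ε x ⟩
    x                  ∎

  conj-self : ∀ g → conj g g ≈ g
  conj-self g = //-rightDividesʳ g g

  conj-∙-comm : ∀ g x → conj g (g ∙ x) ≈ g ∙ conj g x
  conj-∙-comm g x = begin
    g ∙ (g ∙ x) ∙ g ⁻¹  ≈⟨ assoc _ _ _ ⟩
    g ∙ (g ∙ x ∙ g ⁻¹)  ∎

  involution⁻¹ : ∀ {a} → a ∙ a ≈ ε → a ⁻¹ ≈ a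
  involution⁻¹ {a} aa≈ε = sym (inverseˡ-unique a a aa≈ε)

  involution-cancel : ∀ {a} x → a ∙ a ≈ ε → a ∙ (a ∙ x) ≈ x
  involution-cancel {a} x aa≈ε = begin
    a ∙ (a ∙ x)  ≈⟨ assoc a a x ⟨
    a ∙ a ∙ x    ≈⟨ ∙-congʳ aa≈ε ⟩
    ε ∙ x        ≈⟨ identityˡ x ⟩
    x            ∎

  -- The inverse of `a ∙ b` is `b ∙ a`. With `r = a ∙ b`, conjugation by `r` thus moves the list of
  -- reflections `rˡ a` two places on.
  conj-product : ∀ {a b} → a ∙ a ≈ ε → b ∙ b ≈ ε →
                 conj (a ∙ b) a ≈ (a ∙ b) ∙ ((a ∙ b) ∙ a)
  conj-product {a} {b} aa≈ε bb≈ε = begin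
    a ∙ b ∙ a ∙ (a ∙ b) ⁻¹       ≈⟨ ∙-congˡ (⁻¹-anti-homo-∙ a b) ⟩
    a ∙ b ∙ a ∙ (b ⁻¹ ∙ a ⁻¹)    ≈⟨ ∙-congˡ (∙-cong (involution⁻¹ bb≈ε) (involution⁻¹ aa≈ε)) ⟩
    a ∙ b ∙ a ∙ (b ∙ a)          ≈⟨ assoc _ _ _ ⟩
    a ∙ b ∙ (a ∙ (b ∙ a))        ≈⟨ ∙-congˡ (assoc _ _ _) ⟨
    a ∙ b ∙ (a ∙ b ∙ a)          ∎

module _ {c ℓ} (G : Group c ℓ) where
  open Group G

  Generated-mono : ∀ {p q} {A : Pred Carrier p} {B : Pred Carrier q} →
                   A ⊆ Generated G B → Generated G A ⊆ Generated G B
  Generated-mono A⊆ (member a)  = A⊆ a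
  Generated-mono A⊆ unit        = unit
  Generated-mono A⊆ (mul x y)   = mul (Generated-mono A⊆ x) (Generated-mono A⊆ y)
  Generated-mono A⊆ (inv x)     = inv (Generated-mono A⊆ x)
  Generated-mono A⊆ (resp eq x) = resp eq (Generated-mono A⊆ x)

-- The parity cocycle on terms.

module Inversions {c ℓ} (C : CoxeterSystem c ℓ)
                  (_≟_ : Decidable (CoxeterSystem._≈_ C)) where
  open CoxeterSystem C
  open GroupProperties W
  open Conjugation W
  open GroupMorphisms.IsGroupIsomorphism presentation
    using (injective; surjective; ⟦⟧-cong)

  ⟪_⟫ : Term (Fin rank) → Carrier
  ⟪_⟫ = eval W s

  s² : ∀ i → s i ∙ s i ≈ ε
  -- The relator at `(i , i)` has exponent 1; unfolding `_^_` leaves a trailing `one`.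
  s² i = trans (sym (identityʳ _)) (⟦⟧-cong ss≈1)
    where
    ss≈1 : coxeterRelator ⊢ (gen i · gen i) · one ≈ one
    ss≈1 = ≡.subst (λ k → coxeterRelator ⊢ (gen i · gen i) ^ k ≈ one)
                   (diagonal i) (relator (i , i))

  infix 6 _==_

  _==_ : Carrier → Carrier → Bool
  x == y = does (x ≟ y)

  ==-cong : ∀ {x x′ y y′} → x ≈ x′ → y ≈ y′ → (x == y) ≡ (x′ == y′)
  ==-cong p q = does-⇔
    (mk⇔ (λ e → trans (sym p) (trans e q)) (λ e → trans p (trans e (sym q)))) (_ ≟ _) (_ ≟ _)

  ==⇒≈ : ∀ {x y} → (x == y) ≡ true → x ≈ y
  ==⇒≈ {x} {y} eq with x ≟ y
  ... | yes x≈y = x≈y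

  ==-conj : ∀ g x y → (conj (g ⁻¹) x == y) ≡ (x == conj g y)
  ==-conj g x y = does-⇔ (mk⇔
    (λ e → trans (sym (conj-inverse x (inverseʳ g))) (conj-congʳ g e))
    (λ e → trans (conj-congʳ (g ⁻¹) e) (conj-inverse y (inverseˡ g)))) (_ ≟ _) (_ ≟ _)

  -- The cocycle N on terms; the last clause is forced by η (t ⁻ · t) ≡ false.
  η : Term (Fin rank) → Carrier → Bool
  η (gen i) x = x == s i
  η one     x = false
  η (t · u) x = η t x xor η u (conj (⟪ t ⟫ ⁻¹) x)
  η (t ⁻)   x = η t (conj ⟪ t ⟫ x)

  η-cong : ∀ t {x y} → x ≈ y → η t x ≡ η t y
  η-cong (gen i) x≈y = ==-cong x≈y refl
  η-cong one     x≈y = ≡.refl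
  η-cong (t · u) x≈y = ≡.cong₂ _xor_ (η-cong t x≈y) (η-cong u (conj-congʳ _ x≈y))
  η-cong (t ⁻)   x≈y = η-cong t (conj-congʳ _ x≈y)

  -- Reflections of a dihedral word, and vanishing on the relators.

  -- The parity of the number of l < n such that x ≈ rˡ z.
  occurrences : Carrier → ℕ → Carrier → Carrier → Bool
  occurrences r zero    z x = false
  occurrences r (suc n) z x = (x == z) xor occurrences r n (r ∙ z) x

  iterate : Carrier → ℕ → Carrier → Carrier
  iterate r zero    z = z
  iterate r (suc n) z = iterate r n (r ∙ z)

  occurrences-cong : ∀ r n {z z′} x → z ≈ z′ → occurrences r n z x ≡ occurrences r n z′ x
  occurrences-cong r zero    x z≈z′ = ≡.refl
  occurrences-cong r (suc n) x z≈z′ =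
    ≡.cong₂ _xor_ (==-cong refl z≈z′) (occurrences-cong r n x (∙-congˡ z≈z′))

  occurrences-+ : ∀ r m n z x →
    occurrences r (m + n) z x ≡ occurrences r m z x xor occurrences r n (iterate r m z) x
  occurrences-+ r zero    n z x = ≡.refl
  occurrences-+ r (suc m) n z x = ≡.trans
    (≡.cong ((x == z) xor_) (occurrences-+ r m n (r ∙ z) x))
    (≡.sym (xor-assoc (x == z) _ _))

  -- The hypothesis passes from `z` to `r ∙ z`, so conjugating `x` back by `r` amounts to shifting
  -- the whole list by two.
  occurrences-conj : ∀ r n z x → conj r z ≈ r ∙ (r ∙ z) →
    occurrences r n z (conj (r ⁻¹) x) ≡ occurrences r n (r ∙ (r ∙ z)) x
  occurrences-conj r zero    z x h = ≡.refl
  occurrences-conj r (suc n) z x h = ≡.cong₂ _xor_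
    (≡.trans (==-conj r x z) (==-cong refl h))
    (occurrences-conj r n (r ∙ z) x (trans (conj-∙-comm r z) (∙-congˡ h)))

  iterate-∙ : ∀ r n z → iterate r n (r ∙ z) ≈ r ∙ iterate r n z
  iterate-∙ r zero    z = refl
  iterate-∙ r (suc n) z = iterate-∙ r n (r ∙ z)

  iterate-^ : ∀ t n z → iterate ⟪ t ⟫ n z ≈ ⟪ t ^ n ⟫ ∙ z
  iterate-^ t zero    z = sym (identityˡ z)
  iterate-^ t (suc n) z = begin
    iterate ⟪ t ⟫ n (⟪ t ⟫ ∙ z)  ≈⟨ iterate-∙ ⟪ t ⟫ n z ⟩
    ⟪ t ⟫ ∙ iterate ⟪ t ⟫ n z    ≈⟨ ∙-congˡ (iterate-^ t n z) ⟩
    ⟪ t ⟫ ∙ (⟪ t ^ n ⟫ ∙ z)      ≈⟨ assoc _ _ _ ⟨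
    ⟪ t ⟫ ∙ ⟪ t ^ n ⟫ ∙ z        ∎
    where open SetoidReasoning setoid

  -- The reflections of the word (sᵢ sⱼ)ⁿ are rˡ sᵢ for l < 2n, where r = sᵢ sⱼ.
  η-power : ∀ i j n x →
    η ((gen i · gen j) ^ n) x ≡ occurrences (s i ∙ s j) (n * 2) (s i) x
  η-power i j zero    x = ≡.refl
  η-power i j (suc n) x = begin
    ((x == a) xor (conj (a ⁻¹) x == b)) xor η ((gen i · gen j) ^ n) (conj (r ⁻¹) x)
      ≡⟨ ≡.cong₂ (λ p q → ((x == a) xor p) xor q) second rest ⟩
    ((x == a) xor (x == r ∙ a)) xor occurrences r (n * 2) (r ∙ (r ∙ a)) x
      ≡⟨ xor-assoc (x == a) _ _ ⟩
    (x == a) xor ((x == r ∙ a) xor occurrences r (n * 2) (r ∙ (r ∙ a)) x)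
      ∎
    where
    open ≡-Reasoning
    a b r : Carrier
    a = s i
    b = s j
    r = a ∙ b
    second : (conj (a ⁻¹) x == b) ≡ (x == r ∙ a)
    second = ≡.trans (==-conj a x b) (==-cong refl (∙-congˡ (involution⁻¹ (s² i))))
    rest : η ((gen i · gen j) ^ n) (conj (r ⁻¹) x) ≡ occurrences r (n * 2) (r ∙ (r ∙ a)) x
    rest = ≡.trans (η-power i j n (conj (r ⁻¹) x))
                   (occurrences-conj r (n * 2) a x (conj-product (s² i) (s² j)))

  -- Since `rᵏ` is trivial in `W`, the list of `2k` reflections runs twice through the same `k`
  -- elements, and every parity cancels.
  η-relator : ∀ i j x → η (coxeterRelator (i , j)) x ≡ false
  η-relator i j x = begin
    η (t ^ k) x
      ≡⟨ η-power i j k x ⟩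
    occurrences r (k * 2) a x
      ≡⟨ ≡.cong (λ n → occurrences r n a x) k*2≡k+k ⟩
    occurrences r (k + k) a x
      ≡⟨ occurrences-+ r k k a x ⟩
    occurrences r k a x xor occurrences r k (iterate r k a) x
      ≡⟨ ≡.cong (occurrences r k a x xor_) (occurrences-cong r k x rᵏa≈a) ⟩
    occurrences r k a x xor occurrences r k a x
      ≡⟨ xor-same (occurrences r k a x) ⟩
    false
      ∎
    where
    open ≡-Reasoning
    a r : Carrier
    a = s i
    r = s i ∙ s j
    k : ℕ
    k = m i j
    t : Term (Fin rank)
    t = gen i · gen j
    k*2≡k+k : k * 2 ≡ k + k
    k*2≡k+k = ≡.trans (ℕ.*-comm k 2) (≡.cong (k +_) (ℕ.+-identityʳ k))
    rᵏa≈a : iterate r k a ≈ a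
    rᵏa≈a = trans (iterate-^ t k a)
                  (trans (∙-congʳ (⟦⟧-cong (relator (i , j)))) (identityˡ a))

  -- Induction on the derivation. The conjugating elements in `η` depend only on values in `W`, and
  -- the inverse laws hold because a parity cancels against itself.
  η-invariant : ∀ {t u} → coxeterRelator ⊢ t ≈ u → ∀ x → η t x ≡ η u x
  η-invariant ≈-refl        x = ≡.refl
  η-invariant (≈-sym p)     x = ≡.sym (η-invariant p x)
  η-invariant (≈-trans p q) x = ≡.trans (η-invariant p x) (η-invariant q x)
  η-invariant (·-cong {u = u} p q) x = ≡.cong₂ _xor_ (η-invariant p x)
    (≡.trans (η-cong u (conj-cong (⁻¹-cong (⟦⟧-cong p)) refl)) (η-invariant q _))
  η-invariant (⁻-cong {t = t} p) x =
    ≡.trans (η-cong t (conj-cong (⟦⟧-cong p) refl)) (η-invariant p _)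
  η-invariant (·-assoc t u v) x = ≡.trans (xor-assoc (η t x) _ _)
    (≡.cong (λ p → η t x xor (η u (conj (⟪ t ⟫ ⁻¹) x) xor p)) (η-cong v
      (trans (conj-cong (⁻¹-anti-homo-∙ _ _) refl) (conj-∙ _ _ x))))
  η-invariant (·-oneˡ t) x = η-cong t (trans (conj-cong ε⁻¹≈ε refl) (conj-ε x))
  η-invariant (·-oneʳ t) x = xor-identityʳ (η t x)
  η-invariant (·-⁻ˡ t)   x = ≡.trans
    (≡.cong (η t (conj ⟪ t ⟫ x) xor_) (η-cong t (conj-cong (⁻¹-involutive _) refl)))
    (xor-same (η t _))
  η-invariant (·-⁻ʳ t)   x = ≡.trans
    (≡.cong (η t x xor_) (η-cong t (conj-inverse x (inverseʳ ⟪ t ⟫))))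
    (xor-same (η t x))
  η-invariant (relator (i , j)) x = η-relator i j x

  -- The cocycle on `W`.

  term : Carrier → Term (Fin rank)
  term x = proj₁ (surjective x)

  eval-term : ∀ x → ⟪ term x ⟫ ≈ x
  eval-term x = proj₂ (surjective x) ≈-refl

  N : Carrier → Carrier → Bool
  N x = η (term x)

  -- Injectivity of the presentation turns an equality in `W` into a derivation, so any term for `x`
  -- computes `N x`.
  N-eval : ∀ t {x} → x ≈ ⟪ t ⟫ → ∀ y → N x y ≡ η t y
  N-eval t {x} x≈t =
    η-invariant (injective {term x} {t} (trans (eval-term x) x≈t))

  N-congˡ : ∀ {x x′} y → x ≈ x′ → N x y ≡ N x′ y
  N-congˡ {x′ = x′} y x≈x′ = N-eval (term x′) (trans x≈x′ (sym (eval-term x′))) y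

  N-congʳ : ∀ x {y y′} → y ≈ y′ → N x y ≡ N x y′
  N-congʳ x = η-cong (term x)

  N-ε : ∀ y → N ε y ≡ false
  N-ε = N-eval one refl

  N-s : ∀ i y → N (s i) y ≡ (y == s i)
  N-s i = N-eval (gen i) refl

  N-∙ : ∀ x z y → N (x ∙ z) y ≡ N x y xor N z (conj (x ⁻¹) y)
  N-∙ x z y = ≡.trans
    (N-eval (term x · term z) (sym (∙-cong (eval-term x) (eval-term z))) y)
    (≡.cong (N x y xor_) (N-congʳ z (conj-cong (⁻¹-cong (eval-term x)) refl)))

  N-⁻¹ : ∀ x y → N (x ⁻¹) y ≡ N x (conj x y)
  N-⁻¹ x y = ≡.trans
    (N-eval (term x ⁻) (sym (⁻¹-cong (eval-term x))) y)
    (N-congʳ x (conj-cong (eval-term x) refl))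

  N-s∙ : ∀ i z y → N (s i ∙ z) y ≡ (y == s i) xor N z (conj (s i) y)
  N-s∙ i z y = ≡.trans (N-∙ (s i) z y)
    (≡.cong₂ _xor_ (N-s i y) (N-congʳ z (conj-cong (involution⁻¹ (s² i)) refl)))

  -- Conjugation by `s i` fixes `s i`, so prefixing this letter flips the parity there.
  N-ascent : ∀ i x → N x (s i) ≡ false → N (s i ∙ x) (s i) ≡ true
  N-ascent i x eq = ≡.trans (N-s∙ i x (s i))
    (≡.cong₂ _xor_ (dec-true (s i ≟ s i) refl)
                   (≡.trans (N-congʳ x (conj-self (s i))) eq))

  -- The cocycle separates the two: evaluated at `s i`, it is `true` for `s i` and `false` for `ε`.
  s≉ε : ∀ i → ¬ s i ≈ ε
  s≉ε i si≈ε with ≡.trans (≡.sym (dec-true (s i ≟ s i) refl))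
                    (≡.trans (≡.sym (N-s i (s i)))
                      (≡.trans (N-congˡ (s i) si≈ε) (N-ε (s i))))
  ... | ()

  xor-true : ∀ p {q} → p xor q ≡ true → p ≡ true ⊎ q ≡ true
  xor-true false eq = inj₂ eq
  xor-true true  eq = inj₁ ≡.refl

  -- Parabolic subgroups and reduced words

  simple∈ : ∀ {K i} → i ∈ˢ K → Parabolic K (s i)
  simple∈ {i = i} i∈K = member (i , i∈K , refl)

  parabolic-⊆ : ∀ {J K} → (∀ {i} → i ∈ˢ J → Parabolic K (s i)) → Parabolic J ⊆ Parabolic K
  parabolic-⊆ h = Generated-mono W λ { (i , i∈J , x≈si) → resp (sym x≈si) (h i∈J) }

  parabolic-conj : ∀ {K g y} → Parabolic K g → Parabolic K y → Parabolic K (conj g y)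
  parabolic-conj g∈ y∈ = mul (mul g∈ y∈) (inv g∈)

  -- By the cocycle rule an inversion of `x ∙ z` is an inversion of `x` or the `x`-conjugate of one
  -- of `z`, and a subgroup is closed under conjugation by its own elements.
  inversions∈ : ∀ {K x} → Parabolic K x → ∀ y → N x y ≡ true → Parabolic K y
  inversions∈ (member (i , i∈K , x≈si)) y eq =
    resp (sym (==⇒≈ (≡.trans (≡.sym (≡.trans (N-congˡ y x≈si) (N-s i y))) eq))) (simple∈ i∈K)
  inversions∈ unit y eq with ≡.trans (≡.sym (N-ε y)) eq
  ... | ()
  inversions∈ (mul {x} {z} x∈ z∈) y eq with xor-true (N x y) (≡.trans (≡.sym (N-∙ x z y)) eq)
  ... | inj₁ h = inversions∈ x∈ y h
  ... | inj₂ h = resp (conj-inverse y (inverseʳ x)) (parabolic-conj x∈ (inversions∈ z∈ _ h))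
  inversions∈ (inv {x} x∈) y eq = resp (conj-inverse y (inverseˡ x))
    (parabolic-conj (inv x∈) (inversions∈ x∈ _ (≡.trans (≡.sym (N-⁻¹ x y)) eq)))
  inversions∈ (resp x≈x′ x∈) y eq = inversions∈ x∈ y (≡.trans (N-congˡ y x≈x′) eq)

  -- Words in the generators and the exchange condition.

  Word : Set
  Word = List (Fin rank)

  ⟦_⟧ : Word → Carrier
  ⟦ [] ⟧    = ε
  ⟦ i ∷ w ⟧ = s i ∙ ⟦ w ⟧

  ⟦⟧-++ : ∀ w w′ → ⟦ w ++ w′ ⟧ ≈ ⟦ w ⟧ ∙ ⟦ w′ ⟧
  ⟦⟧-++ []      w′ = sym (identityˡ _)
  ⟦⟧-++ (i ∷ w) w′ = trans (∙-congˡ (⟦⟧-++ w w′)) (sym (assoc _ _ _))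

  ⟦⟧-reverse : ∀ w → ⟦ reverse w ⟧ ≈ ⟦ w ⟧ ⁻¹
  ⟦⟧-reverse []      = sym ε⁻¹≈ε
  ⟦⟧-reverse (i ∷ w) = begin
    ⟦ reverse (i ∷ w) ⟧        ≡⟨ ≡.cong ⟦_⟧ (unfold-reverse i w) ⟩
    ⟦ reverse w ++ i ∷ [] ⟧    ≈⟨ ⟦⟧-++ (reverse w) (i ∷ []) ⟩
    ⟦ reverse w ⟧ ∙ (s i ∙ ε)  ≈⟨ ∙-cong (⟦⟧-reverse w) (identityʳ (s i)) ⟩
    ⟦ w ⟧ ⁻¹ ∙ s i             ≈⟨ ∙-congˡ (involution⁻¹ (s² i)) ⟨
    ⟦ w ⟧ ⁻¹ ∙ s i ⁻¹          ≈⟨ ⁻¹-anti-homo-∙ (s i) ⟦ w ⟧ ⟨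
    (s i ∙ ⟦ w ⟧) ⁻¹           ∎
    where open SetoidReasoning setoid

  -- The generators are involutions, so words without inverses suffice and inversion becomes
  -- reversal.
  word : Term (Fin rank) → Word
  word (gen i) = i ∷ []
  word one     = []
  word (t · u) = word t ++ word u
  word (t ⁻)   = reverse (word t)

  ⟦word⟧ : ∀ t → ⟦ word t ⟧ ≈ ⟪ t ⟫
  ⟦word⟧ (gen i) = identityʳ (s i)
  ⟦word⟧ one     = refl
  ⟦word⟧ (t · u) = trans (⟦⟧-++ (word t) (word u)) (∙-cong (⟦word⟧ t) (⟦word⟧ u))
  ⟦word⟧ (t ⁻)   = trans (⟦⟧-reverse (word t)) (⁻¹-cong (⟦word⟧ t))

  -- Either `y` equals the first letter, which is deleted, or the conjugate of `y` by that letter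
  -- has odd count in the tail. In the second case the letter to delete lies in the tail, because
  -- `y ∙ s i = s i ∙ conj (s i) y`.
  exchange : ∀ w y → N ⟦ w ⟧ y ≡ true →
             ∃[ w′ ] (suc (length w′) ≡ length w × y ∙ ⟦ w ⟧ ≈ ⟦ w′ ⟧)
  exchange [] y eq with ≡.trans (≡.sym (N-ε y)) eq
  ... | ()
  exchange (i ∷ w) y eq with xor-true (y == s i) (≡.trans (≡.sym (N-s∙ i ⟦ w ⟧ y)) eq)
  ... | inj₁ h = w , ≡.refl , trans (∙-congʳ (==⇒≈ h)) (involution-cancel ⟦ w ⟧ (s² i))
  ... | inj₂ h with exchange w (conj (s i) y) h
  ...   | w′ , len , yw≈w′ = i ∷ w′ , ≡.cong suc len , (begin
    y ∙ (s i ∙ ⟦ w ⟧)                       ≈⟨ involution-cancel _ (s² i) ⟨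
    s i ∙ (s i ∙ (y ∙ (s i ∙ ⟦ w ⟧)))       ≈⟨ ∙-congˡ (∙-congˡ (assoc y (s i) ⟦ w ⟧)) ⟨
    s i ∙ (s i ∙ (y ∙ s i ∙ ⟦ w ⟧))         ≈⟨ ∙-congˡ (assoc (s i) _ ⟦ w ⟧) ⟨
    s i ∙ (s i ∙ (y ∙ s i) ∙ ⟦ w ⟧)         ≈⟨ ∙-congˡ (∙-congʳ (assoc (s i) y (s i))) ⟨
    s i ∙ (s i ∙ y ∙ s i ∙ ⟦ w ⟧)           ≈⟨ ∙-congˡ (∙-congʳ (∙-congˡ (involution⁻¹ (s² i)))) ⟨
    s i ∙ (conj (s i) y ∙ ⟦ w ⟧)            ≈⟨ ∙-congˡ yw≈w′ ⟩
    s i ∙ ⟦ w′ ⟧                            ∎)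
    where open SetoidReasoning setoid

  -- Reducedness is expressed by ascents rather than minimal length: no letter is an inversion of
  -- the word after it. This is the form that peeling off letters consumes.
  data Reduced : Word → Set where
    []  : Reduced []
    _∷_ : ∀ {i w} → N ⟦ w ⟧ (s i) ≡ false → Reduced w → Reduced (i ∷ w)

  -- The recursion is on `n`. The length bound in the conclusion lets the word `b′` left by an
  -- exchange be reduced again with the smaller bound.
  reduce : ∀ n w → length w ≤ n → ∃[ b ] (length b ≤ n × Reduced b × ⟦ w ⟧ ≈ ⟦ b ⟧)
  reduce n       []      _         = [] , z≤n , [] , refl
  reduce (suc n) (i ∷ w) (s≤s w≤n) with reduce n w w≤n
  ... | b , b≤n , red , w≈b with N ⟦ b ⟧ (s i) in eq
  ...   | false = i ∷ b , s≤s b≤n , eq ∷ red , ∙-congˡ w≈b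
  ...   | true with exchange b (s i) eq
  ...     | b′ , len , sb≈b′ with reduce n b′ (ℕ.<⇒≤ (≡.subst (_≤ n) (≡.sym len) b≤n))
  ...       | b″ , b″≤n , red″ , b′≈b″ =
    b″ , ℕ.m≤n⇒m≤1+n b″≤n , red″ , trans (∙-congˡ w≈b) (trans sb≈b′ b′≈b″)

  reducedWord : ∀ x → ∃[ b ] (Reduced b × x ≈ ⟦ b ⟧)
  reducedWord x with reduce _ (word (term x)) ℕ.≤-refl
  ... | b , _ , red , w≈b =
    b , red , trans (sym (trans (⟦word⟧ (term x)) (eval-term x))) w≈b

  -- The ascent makes `s i` an inversion of `s i ∙ x`, and inversions of an element of `W_K` stay in
  -- `W_K`.
  ascent∈ : ∀ {K} i x → N x (s i) ≡ false → Parabolic K (s i ∙ x) → Parabolic K (s i)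
  ascent∈ i x eq six∈ = inversions∈ six∈ (s i) (N-ascent i x eq)

  tail∈ : ∀ {K i x} → Parabolic K (s i) → Parabolic K (s i ∙ x) → Parabolic K x
  tail∈ {i = i} si∈ six∈ = resp (involution-cancel _ (s² i)) (mul si∈ six∈)

  letters∈ : ∀ {K b} → Reduced b → Parabolic K ⟦ b ⟧ → All (Parabolic K ∘ s) b
  letters∈ []                        b∈ = []
  letters∈ (_∷_ {i} {w} ascent red) b∈ = si∈ ∷ letters∈ red (tail∈ si∈ b∈)
    where si∈ = ascent∈ i ⟦ w ⟧ ascent b∈

  -- Supports of words and the parabolic subgroups they generate.

  support : Word → Subset rank
  support []      = ⊥
  support (i ∷ w) = ⁅ i ⁆ ∪ support w

  support-⊆ : ∀ {K b} → All (Parabolic K ∘ s) b → Parabolic (support b) ⊆ Parabolic K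
  support-⊆ {K} all = parabolic-⊆ (go all)
    where
    go : ∀ {b} → All (Parabolic K ∘ s) b → ∀ {i} → i ∈ˢ support b → Parabolic K (s i)
    go [] i∈ = ⊥-elim (∉⊥ i∈)
    go {j ∷ b} (sj∈ ∷ all) {i} i∈ with x∈p∪q⁻ ⁅ j ⁆ (support b) i∈
    ... | inj₂ i∈b = go all i∈b
    ... | inj₁ i∈j with x∈⁅y⁆⇒x≡y j i∈j
    ...   | ≡.refl = sj∈

  ⟦⟧∈support : ∀ b → Parabolic (support b) ⟦ b ⟧
  ⟦⟧∈support []      = unit
  ⟦⟧∈support (i ∷ b) = mul
    (simple∈ (p⊆p∪q (support b) (x∈⁅x⁆ i)))
    (parabolic-⊆ (simple∈ ∘ q⊆p∪q ⁅ i ⁆ (support b)) (⟦⟧∈support b))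

  -- Edges and paths of the permutahedron

  open FaceStructure (Perm C)
    using (Adjacent; _⟶_; Path; [_]; _∷_; IsGeodesic; StaysIn; IsMinimalFace; InYourFace)
    renaming (length to steps)

  centre∈ : ∀ {v J} → v ∈Coset (v , J)
  centre∈ = ε , unit , sym (identityʳ _)

  coset-∙ : ∀ {v J u u′ y} → u ∈Coset (v , J) → Parabolic J y → u ∙ y ≈ u′ → u′ ∈Coset (v , J)
  coset-∙ {y = y} (z , z∈ , u≈vz) y∈ uy≈u′ =
    z ∙ y , mul z∈ y∈ , trans (sym uy≈u′) (trans (∙-congʳ u≈vz) (assoc _ _ _))

  cosetQuotient : ∀ {v J u u′} → u ∈Coset (v , J) → u′ ∈Coset (v , J) → Parabolic J (u ⁻¹ ∙ u′)
  cosetQuotient {v} {J} {u} {u′} (y , y∈ , u≈) (y′ , y′∈ , u′≈) =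
    resp (sym eq) (mul (inv y∈) y′∈)
    where
    open SetoidReasoning setoid
    eq : u ⁻¹ ∙ u′ ≈ y ⁻¹ ∙ y′
    eq = begin
      u ⁻¹ ∙ u′                     ≈⟨ ∙-cong (⁻¹-cong u≈) u′≈ ⟩
      (v ∙ y) ⁻¹ ∙ (v ∙ y′)         ≈⟨ ∙-congʳ (⁻¹-anti-homo-∙ v y) ⟩
      y ⁻¹ ∙ v ⁻¹ ∙ (v ∙ y′)        ≈⟨ assoc _ _ _ ⟩
      y ⁻¹ ∙ (v ⁻¹ ∙ (v ∙ y′))      ≈⟨ ∙-congˡ (\\-leftDividesʳ v y′) ⟩
      y ⁻¹ ∙ y′                     ∎

  parabolic-⊥ : ∀ {J} → (∀ {i} → ¬ i ∈ˢ J) → ∀ {y} → Parabolic J y → y ≈ ε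
  parabolic-⊥ J≡⊥ (member (i , i∈J , _)) = ⊥-elim (J≡⊥ i∈J)
  parabolic-⊥ J≡⊥ unit        = refl
  parabolic-⊥ J≡⊥ (mul p q)   = trans (∙-cong (parabolic-⊥ J≡⊥ p) (parabolic-⊥ J≡⊥ q)) (identityˡ ε)
  parabolic-⊥ J≡⊥ (inv p)     = trans (⁻¹-cong (parabolic-⊥ J≡⊥ p)) ε⁻¹≈ε
  parabolic-⊥ J≡⊥ (resp eq p) = trans (sym eq) (parabolic-⊥ J≡⊥ p)

  parabolic-⁅⁆ : ∀ i {y} → Parabolic ⁅ i ⁆ y → y ≈ ε ⊎ y ≈ s i
  parabolic-⁅⁆ i (member (j , j∈ , y≈sj)) with x∈⁅y⁆⇒x≡y i j∈
  ... | ≡.refl = inj₂ y≈sj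
  parabolic-⁅⁆ i unit = inj₁ refl
  parabolic-⁅⁆ i (mul p q) with parabolic-⁅⁆ i p | parabolic-⁅⁆ i q
  ... | inj₁ x≈ε | inj₁ y≈ε = inj₁ (trans (∙-cong x≈ε y≈ε) (identityˡ ε))
  ... | inj₁ x≈ε | inj₂ y≈s = inj₂ (trans (∙-cong x≈ε y≈s) (identityˡ (s i)))
  ... | inj₂ x≈s | inj₁ y≈ε = inj₂ (trans (∙-cong x≈s y≈ε) (identityʳ (s i)))
  ... | inj₂ x≈s | inj₂ y≈s = inj₁ (trans (∙-cong x≈s y≈s) (s² i))
  parabolic-⁅⁆ i (inv p) with parabolic-⁅⁆ i p
  ... | inj₁ x≈ε = inj₁ (trans (⁻¹-cong x≈ε) ε⁻¹≈ε)
  ... | inj₂ x≈s = inj₂ (trans (⁻¹-cong x≈s) (involution⁻¹ (s² i)))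
  parabolic-⁅⁆ i (resp eq p) = [ inj₁ ∘ trans (sym eq) , inj₂ ∘ trans (sym eq) ]′ (parabolic-⁅⁆ i p)

  v≉vs : ∀ v i → ¬ v ≈ v ∙ s i
  v≉vs v i v≈vs = s≉ε i (∙-cancelˡ v _ _ (trans (sym v≈vs) (sym (identityʳ v))))

  edge : ∀ v i → Adjacent v (v ∙ s i)
  edge v i = v≉vs v i , (v , ⁅ i ⁆) , λ u → mk⇔ to from
    where
    to : ∀ {u} → u ∈Coset (v , ⁅ i ⁆) → u ≈ v ⊎ u ≈ v ∙ s i
    to (y , y∈ , u≈vy) with parabolic-⁅⁆ i y∈
    ... | inj₁ y≈ε = inj₁ (trans u≈vy (trans (∙-congˡ y≈ε) (identityʳ v)))
    ... | inj₂ y≈s = inj₂ (trans u≈vy (∙-congˡ y≈s))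
    from : ∀ {u} → u ≈ v ⊎ u ≈ v ∙ s i → u ∈Coset (v , ⁅ i ⁆)
    from (inj₁ u≈v)  = ε , unit , trans u≈v (sym (identityʳ v))
    from (inj₂ u≈vs) = s i , simple∈ (x∈⁅x⁆ i) , u≈vs

  -- The edge is some coset of `W_J`. An empty `J` would force `v ≈ u`; otherwise any `i` in `J`
  -- gives a vertex `v ∙ s i` of the edge other than `v`, which must be `u`.
  adjacent⇒simple : ∀ {v u} → Adjacent v u → ∃[ i ] v ∙ s i ≈ u
  adjacent⇒simple {v} {u} (v≉u , (w , J) , F⇔) with nonempty? J
  ... | no J≡⊥ = ⊥-elim (v≉u (∙-cancelˡ (v ⁻¹) _ _
          (trans (inverseˡ v) (sym (parabolic-⊥ (λ i∈ → J≡⊥ (_ , i∈)) (cosetQuotient v∈ u∈))))))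
    where
    v∈ = Equivalence.from (F⇔ v) (inj₁ refl)
    u∈ = Equivalence.from (F⇔ u) (inj₂ refl)
  ... | yes (i , i∈J) with Equivalence.to (F⇔ (v ∙ s i))
          (coset-∙ (Equivalence.from (F⇔ v) (inj₁ refl)) (simple∈ i∈J) refl)
  ...   | inj₁ vs≈v = ⊥-elim (v≉vs v i (sym vs≈v))
  ...   | inj₂ vs≈u = i , vs≈u

  -- Translation between paths and words.

  wordPath : ∀ {v v′} w → v ∙ ⟦ w ⟧ ≈ v′ → Σ[ q ∈ Path v v′ ] steps q ≡ length w
  wordPath []      eq = [ trans (sym (identityʳ _)) eq ] , ≡.refl
  wordPath {v} (i ∷ w) eq with wordPath w (trans (assoc v (s i) ⟦ w ⟧) eq)
  ... | q , len = inj₁ (edge v i) ∷ q , ≡.cong suc len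

  -- Stationary steps contribute no letter, hence only an inequality of lengths.
  pathWord : ∀ {v v′} (p : Path v v′) → ∃[ w ] (length w ≤ steps p × v ∙ ⟦ w ⟧ ≈ v′)
  pathWord [ v≈v′ ] = [] , z≤n , trans (identityʳ _) v≈v′
  pathWord (inj₂ v≈u ∷ p) with pathWord p
  ... | w , len , uw≈v′ = w , ℕ.m≤n⇒m≤1+n len , trans (∙-congʳ v≈u) uw≈v′
  pathWord (inj₁ adj ∷ p) with adjacent⇒simple adj | pathWord p
  ... | i , vs≈u | w , len , uw≈v′ =
    i ∷ w , s≤s len , trans (sym (assoc _ _ _)) (trans (∙-congʳ vs≈u) uw≈v′)

  geodesic≤word : ∀ {v v′} (p : Path v v′) → IsGeodesic p →
                  ∀ w → v ∙ ⟦ w ⟧ ≈ v′ → steps p ≤ length w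
  geodesic≤word p geo w eq with wordPath w eq
  ... | q , len = ≡.subst (steps p ≤_) len (geo q)

  geodesic-tail : ∀ {v u v′} (st : v ⟶ u) (p : Path u v′) →
                  IsGeodesic (st ∷ p) → IsGeodesic p
  geodesic-tail st p geo q = ℕ.≤-pred (geo (st ∷ q))

  -- Both hypotheses on `u` are invariants of the walk: minimality makes each letter an ascent of
  -- the remaining word, so the letter lies in `W_J` and so does the remaining quotient.
  geodesic-staysIn : ∀ {v J u v′} (p : Path u v′) → IsGeodesic p →
    u ∈Coset (v , J) → Parabolic J (u ⁻¹ ∙ v′) → StaysIn (v , J) p
  geodesic-staysIn [ _ ] geo u∈ _ = u∈
  -- A stationary step contradicts minimality, since the word of the rest already joins the
  -- endpoints.
  geodesic-staysIn (inj₂ u≈u′ ∷ p) geo u∈ _ with pathWord p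
  ... | w , len , u′w≈v′ = ⊥-elim (ℕ.<⇒≱ (s≤s len)
          (geodesic≤word (inj₂ u≈u′ ∷ p) geo w (trans (∙-congʳ u≈u′) u′w≈v′)))
  geodesic-staysIn {v} {J} {u} {v′} (_∷_ {u′} (inj₁ adj) p) geo u∈ x∈
    with adjacent⇒simple adj | pathWord p
  ... | i , us≈u′ | w , len , u′w≈v′ = u∈ ,
    geodesic-staysIn p (geodesic-tail (inj₁ adj) p geo) (coset-∙ u∈ si∈ us≈u′)
      (resp (y≈x\\z u′ ⟦ w ⟧ v′ u′w≈v′) (tail∈ si∈ sw∈))
    where
    usw≈v′ : u ∙ (s i ∙ ⟦ w ⟧) ≈ v′
    usw≈v′ = trans (sym (assoc _ _ _)) (trans (∙-congʳ us≈u′) u′w≈v′)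
    sw∈ : Parabolic J (s i ∙ ⟦ w ⟧)
    sw∈ = resp (sym (y≈x\\z u _ v′ usw≈v′)) x∈
    -- Otherwise the exchange condition would give a path with two steps fewer.
    ascent : N ⟦ w ⟧ (s i) ≡ false
    ascent with N ⟦ w ⟧ (s i) in eq
    ... | false = ≡.refl
    ... | true with exchange w (s i) eq
    ...   | w′ , len′ , sw≈w′ = ⊥-elim (ℕ.<⇒≱
            (s≤s (ℕ.≤-trans (ℕ.<⇒≤ (ℕ.≤-reflexive len′)) len))
            (geodesic≤word (inj₁ adj ∷ p) geo w′ (trans (∙-congˡ (sym sw≈w′)) usw≈v′)))
    si∈ : Parabolic J (s i)
    si∈ = ascent∈ i ⟦ w ⟧ ascent sw∈

  inYourFace : InYourFace
  inYourFace v v′ with reducedWord (v ⁻¹ ∙ v′)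
  -- The minimal face is the coset of `v` for the letters of a reduced word of `v ⁻¹ ∙ v′`.
  ... | b , red , x≈b = (v , support b) ,
    (centre∈ , (⟦ b ⟧ , ⟦⟧∈support b , v′≈vb) , minimal) ,
    λ p geo → geodesic-staysIn p geo centre∈ (resp (sym x≈b) (⟦⟧∈support b))
    where
    v′≈vb : v′ ≈ v ∙ ⟦ b ⟧
    v′≈vb = trans (sym (\\-leftDividesˡ v v′)) (∙-congˡ x≈b)
    minimal : ∀ G → v ∈Coset G → v′ ∈Coset G → ∀ u → u ∈Coset (v , support b) → u ∈Coset G
    -- A face of type `K` containing both vertices has `v ⁻¹ ∙ v′` in `W_K`, which forces every
    -- letter of `b` into `W_K`.
    minimal (g , K) v∈ v′∈ u (z , z∈ , u≈vz) = coset-∙ v∈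
      (support-⊆ (letters∈ red (resp x≈b (cosetQuotient v∈ v′∈))) z∈) (sym u≈vz)

theorem3p2 : ∀ {c ℓ} (C : CoxeterSystem c ℓ) → Finite C → FaceStructure.InYourFace (Perm C)
-- The bijection with `Fin` decides equality in `W`, which the Boolean counts of reflections rest
-- on.
theorem3p2 C (_ , W↔Fin) = Inversions.inYourFace C
  (via-injection (Inverse⇒Injection W↔Fin) Fin._≟_)
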